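{- Let $\mathbf P=(P,\le,1)$ be a poset with greatest element $1$, let $\mathbf Q=(Q,\le,0)$ be a poset with least element $0$, let $a$ be an atom of $\mathbf Q$ and let $b\in P$. Suppose there exist some coatom $c$ of $\mathbf P$ with $c\not\ge b$ and $(\downarrow c)\cup[b,1]=P$, and some $d\in Q$ with $d\not\ge a$ and $[0,d]\cup(\uparrow a)=Q$. Then the mapping $f\colon P\to Q$ defined by \[ f(x):=\begin{cases} a & \text{if }x\ge b,\\ 0 & \text{otherwise}\end{cases} \] is a weakly regular residuated mapping from $\mathbf P$ to $\mathbf Q$.
   Context: $\downarrow c=\{x\in P\mid x\le c\}$, $\uparrow a=\{y\in Q\mid a\le y\}$, and $[u,v]=\{x\mid u\le x\le v\}$. An atom is an element covering the least element $0$; a coatom is an element covered by the greatest element $1$. A mapping $f\colon P\to Q$ between posets is residuated if there is a mapping $f^*\colon Q\to P$ such that for all $x\in P$, $y\in Q$: $f(x)\le y$ if and only if $x\le f^*(y)$; such $f^*$ is uniquely determined by $f$. For $\mathbf P$ with greatest element $1$ and $\mathbf Q$ with least element $0$, a residuated mapping $f$ is called range-closed if $f(P)=[0,f(1)]$, dually range-closed if $f^*(Q)=[f^*(0),1]$, and weakly regular if it is both range-closed and dually range-closed. -}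

module Defs where

open import Axiom.ExcludedMiddle using (ExcludedMiddle)
open import Data.Bool.Base using (if_then_else_)
open import Data.Product.Base using (Σ-syntax; ∃-syntax; _×_)
open import Level using (Level; _⊔_; Setω)
open import Relation.Binary.Bundles using (Poset)
open import Relation.Binary.Definitions using (Adjoint)
import Relation.Binary.Properties.Poset as PosetProperties
open import Relation.Nullary.Decidable.Core using (does)
open import Relation.Nullary.Negation.Core using (¬_)
open import Relation.Unary using (Pred; _≐_)

private
  variable
    p p₁ p₂ q q₁ q₂ : Level

-- Order theory here is classical, so excluded middle at every level is an
-- explicit hypothesis: arbitrary posets need not have decidable order or
-- equality.
Classical : Setω
Classical = ∀ {ℓ} → ExcludedMiddle ℓ

module _ (P : Poset p p₁ p₂) where
  open Poset P
  open PosetProperties P using (_<_)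

  ↓ : Carrier → Pred Carrier p₂
  ↓ c x = x ≤ c

  ↑ : Carrier → Pred Carrier p₂
  ↑ a x = a ≤ x

  Interval : Carrier → Carrier → Pred Carrier p₂
  Interval u v x = u ≤ x × x ≤ v

  -- Covers y x: y covers x.
  Covers : Carrier → Carrier → Set (p ⊔ p₁ ⊔ p₂)
  Covers y x = x < y × ¬ (∃[ z ] (x < z × z < y))

  -- 0# and 1# are meant to be the least and greatest elements.
  Atom : (0# : Carrier) → Pred Carrier (p ⊔ p₁ ⊔ p₂)
  Atom 0# a = Covers a 0#

  Coatom : (1# : Carrier) → Pred Carrier (p ⊔ p₁ ⊔ p₂)
  Coatom 1# c = Covers 1# c

-- The set f(A), closed under the equality of the codomain.
Image : {A : Set p} (Q : Poset q q₁ q₂) →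
        (A → Poset.Carrier Q) → Pred (Poset.Carrier Q) (p ⊔ q₁)
Image Q f y = ∃[ x ] f x ≈ y
  where open Poset Q

module _ (P : Poset p p₁ p₂) (Q : Poset q q₁ q₂) where
  private
    module P = Poset P
    module Q = Poset Q

  IsResidual : (P.Carrier → Q.Carrier) → (Q.Carrier → P.Carrier) →
               Set (p ⊔ p₂ ⊔ q ⊔ q₂)
  IsResidual f f* = Adjoint P._≤_ Q._≤_ f f*

  RangeClosed : P.Carrier → Q.Carrier → Pred (P.Carrier → Q.Carrier) (p ⊔ q ⊔ q₁ ⊔ q₂)
  RangeClosed 1# 0# f = Image Q f ≐ Interval Q 0# (f 1#)

  -- A condition on the residual f* : Q → P of a map P → Q.
  DuallyRangeClosed : P.Carrier → Q.Carrier → Pred (Q.Carrier → P.Carrier) (p ⊔ p₁ ⊔ p₂ ⊔ q)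
  DuallyRangeClosed 1# 0# f* = Image P f* ≐ Interval P (f* 0#) 1#

  -- The residual is unique up to P._≈_, so it does not matter which one
  -- witnesses the second condition.
  WeaklyRegularResiduated : P.Carrier → Q.Carrier →
                            Pred (P.Carrier → Q.Carrier) (p ⊔ p₁ ⊔ p₂ ⊔ q ⊔ q₁ ⊔ q₂)
  WeaklyRegularResiduated 1# 0# f =
    Σ[ f* ∈ (Q.Carrier → P.Carrier) ]
      IsResidual f f* × RangeClosed 1# 0# f × DuallyRangeClosed 1# 0# f*

  stepMap : Classical → P.Carrier → Q.Carrier → Q.Carrier → (P.Carrier → Q.Carrier)
  stepMap em b a 0# x = if does (em {P = b P.≤ x}) then a else 0#

{-# OPTIONS --safe #-}
-- The map f sends ↑ b to a and its complement to 0.  Since ↓ c is exactly the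
-- complement of ↑ b, the residual f* is again a step map: it sends ↑ a to 1
-- and its complement to c.  Each of f and f* has as its range the two ends of
-- a covering pair, 0 ⋖ a and c ⋖ 1 respectively, hence an interval.
module Submission where

open import Defs
open import Data.Empty using (⊥-elim)
open import Data.Product.Base using (∃-syntax; _×_; _,_; proj₁; proj₂)
open import Data.Sum.Base using (_⊎_; inj₁; inj₂)
open import Data.Unit.Base using (tt)
open import Relation.Binary.Bundles using (Poset)
open import Relation.Binary.Definitions using (Maximum; Minimum)
open import Relation.Binary.PropositionalEquality.Core using (_≡_; refl; sym; subst)
open import Relation.Nullary.Decidable.Core using (yes; no)
open import Relation.Nullary.Negation.Core using (¬_)
open import Relation.Unary using (_∪_; _≐_; U)

module _ (em : Classical) {p p₁ p₂} (P : Poset p p₁ p₂) where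
  private module P = Poset P

  -- A point equal to neither end would lie strictly between them, which covering forbids; excluded
  -- middle decides the two equalities.
  covers⇒endpoint : ∀ {s t z} → Covers P t s → Interval P s t z →
                    s P.≈ z ⊎ t P.≈ z
  covers⇒endpoint {s} {t} {z} (_ , empty) (s≤z , z≤t)
    with em {P = s P.≈ z} | em {P = z P.≈ t}
  ... | yes s≈z | _       = inj₁ s≈z
  ... | no _    | yes z≈t = inj₂ (P.Eq.sym z≈t)
  ... | no s≉z  | no z≉t  = ⊥-elim (empty (z , (s≤z , s≉z) , (z≤t , z≉t)))

module _ (em : Classical) {p p₁ p₂ q q₁ q₂}
         (P : Poset p p₁ p₂) (Q : Poset q q₁ q₂) where
  private
    module P = Poset P
    module Q = Poset Q

  stepMap-≤ : ∀ {b x} t s → b P.≤ x → stepMap P Q em b t s x ≡ t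
  stepMap-≤ {b} {x} t s b≤x with em {P = b P.≤ x}
  ... | yes _   = refl
  ... | no  b≰x = ⊥-elim (b≰x b≤x)

  stepMap-≰ : ∀ {b x} t s → ¬ b P.≤ x → stepMap P Q em b t s x ≡ s
  stepMap-≰ {b} {x} t s b≰x with em {P = b P.≤ x}
  ... | yes b≤x = ⊥-elim (b≰x b≤x)
  ... | no  _   = refl

  -- The points `x` and `y` ensure that both values are attained, and covering leaves no other point
  -- in the interval. Applied again with the posets exchanged, this also yields the range of the
  -- residual.
  stepMap-image : ∀ {b t s x y} → Covers Q t s → b P.≤ x → ¬ b P.≤ y →
                  Image Q (stepMap P Q em b t s) ≐ Interval Q s t
  stepMap-image {b} {t} {s} {x} {y} t⋗s@((s≤t , _) , _) b≤x b≰y = ⊆ , ⊇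
    where
    f = stepMap P Q em b t s

    bounds : ∀ x → Interval Q s t (f x)
    bounds x with em {P = b P.≤ x}
    ... | yes _ = s≤t , Q.refl
    ... | no  _ = Q.refl , s≤t

    ⊆ : ∀ {z} → Image Q f z → Interval Q s t z
    ⊆ (x , fx≈z) = Q.≤-respʳ-≈ fx≈z (proj₁ (bounds x))
                 , Q.≤-respˡ-≈ fx≈z (proj₂ (bounds x))

    ⊇ : ∀ {z} → Interval Q s t z → Image Q f z
    ⊇ {z} z∈[s,t] with covers⇒endpoint em Q t⋗s z∈[s,t]
    ... | inj₁ s≈z = y , subst (Q._≈ z) (sym (stepMap-≰ t s b≰y)) s≈z
    ... | inj₂ t≈z = x , subst (Q._≈ z) (sym (stepMap-≤ t s b≤x)) t≈z

  -- Both sides of the adjunction hold trivially or by the bound `c`, except when `b ≤ x` and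
  -- `a ≰ y`. There both fail: `x ≤ c` would give `b ≤ c` by transitivity.
  stepMap-residual : ∀ {1# 0# a b c} → Maximum P._≤_ 1# → Minimum Q._≤_ 0# →
                     ¬ b P.≤ c → (∀ {x} → ¬ b P.≤ x → x P.≤ c) →
                     IsResidual P Q (stepMap P Q em b a 0#) (stepMap Q P em a 1# c)
  stepMap-residual {a = a} {b} max min b≰c b≰⇒≤c {x} {y}
    with em {P = b P.≤ x} | em {P = a Q.≤ y}
  ... | yes _   | yes a≤y = (λ _ → max x) , (λ _ → a≤y)
  ... | yes b≤x | no  a≰y = (λ a≤y → ⊥-elim (a≰y a≤y))
                          , (λ x≤c → ⊥-elim (b≰c (P.trans b≤x x≤c)))
  ... | no _    | yes _   = (λ _ → max x) , (λ _ → min y)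
  ... | no b≰x  | no _    = (λ _ → b≰⇒≤c b≰x) , (λ _ → min y)

theorem5p3 : (em : Classical) →
    ∀ {p p₁ p₂ q q₁ q₂} (P : Poset p p₁ p₂) (Q : Poset q q₁ q₂) →
    let module P = Poset P
        module Q = Poset Q
    in
    (1# : P.Carrier) → Maximum P._≤_ 1# →
    (0# : Q.Carrier) → Minimum Q._≤_ 0# →
    (a : Q.Carrier) → Atom Q 0# a →
    (b : P.Carrier) →
    ∃[ c ] (Coatom P 1# c × ¬ (b P.≤ c) × (↓ P c ∪ Interval P b 1#) ≐ U) →
    ∃[ d ] (¬ (a Q.≤ d) × (Interval Q 0# d ∪ ↑ Q a) ≐ U) →
    WeaklyRegularResiduated P Q 1# 0# (stepMap P Q em b a 0#)
theorem5p3 em P Q 1# max 0# min a a⋗0@((0≤a , 0≉a) , _) b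
           (c , 1⋗c , b≰c , _ , covered) _ =
    f*
  , stepMap-residual em P Q max min b≰c b≰⇒≤c
  -- The upper end must be `f 1#`, which equals `a` only propositionally, via `b ≤ 1#`. The value
  -- `a` is attained at `1#` and `0#` at `c`.
  , subst (λ t → Image Q f ≐ Interval Q 0# t)
          (sym (stepMap-≤ em P Q a 0# (max b)))
          (stepMap-image em P Q a⋗0 (max b) b≰c)
  -- Dually, `f* 0#` is `c` because `0#` is not above `a`. The value `1#` is attained at `a` itself
  -- and `c` at `0#`.
  , subst (λ s → Image P f* ≐ Interval P s 1#)
          (sym (stepMap-≰ em Q P 1# c a≰0))
          (stepMap-image em Q P 1⋗c Q.refl a≰0)
  where
  module P = Poset P
  module Q = Poset Q

  f  = stepMap P Q em b a 0#
  f* = stepMap Q P em a 1# c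

  a≰0 : ¬ a Q.≤ 0#
  a≰0 a≤0 = 0≉a (Q.antisym 0≤a a≤0)

  b≰⇒≤c : ∀ {x} → ¬ b P.≤ x → x P.≤ c
  b≰⇒≤c {x} b≰x with covered {x} tt
  ... | inj₁ x≤c       = x≤c
  ... | inj₂ (b≤x , _) = ⊥-elim (b≰x b≤x)
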